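{- Let $G^*$ be a $(k,r)$-regular hypergraph with $n$ vertices whose adjacency spectrum (eigenvalues of the adjacency matrix listed with multiplicity) is $\lambda_1=r(k-1),\lambda_2,\lambda_3,\dots,\lambda_n$. Then the Seidel spectrum of $G^*$ (eigenvalues of the Seidel matrix listed with multiplicity) is $$n-1-2\lambda_1,\ -1-2\lambda_2,\ -1-2\lambda_3,\ \dots,\ -1-2\lambda_n.$$
   Context: A hypergraph $G^*=(V,E)$ of order $n$ has a finite vertex set $V=\{v_1,\dots,v_n\}$ and a finite set $E$ of hyperedges, each a subset of $V$. It is $k$-uniform ($k\ge2$) if every hyperedge has cardinality $k$, $r$-regular if every vertex lies in exactly $r$ hyperedges, and $(k,r)$-regular if it is both. Its adjacency matrix $A=(a_{ij})$ has $a_{ij}=|\{e\in E:\{v_i,v_j\}\subset e\}|$ for $i\ne j$ and $a_{ii}=0$. Its Seidel matrix is $S=J_n-I_n-2A$, where $J_n$ is the all-ones matrix and $I_n$ the identity matrix of order $n$. For a $(k,r)$-regular hypergraph, $r(k-1)$ is an eigenvalue of $A$. -}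

module Defs where

open import Algebra.Apartness.Bundles using (HeytingField)
open import Algebra.Bundles using (CommutativeRing)
open import Algebra.Bundles.Raw using (RawRing)
import Algebra.Definitions.RawSemiring as RawSemiringDefs
open import Data.Bool.Base using (if_then_else_)
open import Data.Fin.Base using (Fin; zero; suc; toℕ)
import Data.Fin.Properties as Fin
open import Data.Fin.Subset using (Subset; _⊆_; _∈_; _∪_; ⁅_⁆; ∣_∣)
open import Data.Fin.Subset.Properties using (_∈?_; _⊆?_)
open import Data.List.Base using (List; []; _∷_; length; filter; map)
open import Data.List.Relation.Unary.All using (All)
open import Data.List.Relation.Unary.Unique.Propositional using (Unique)
open import Data.Nat.Base using (ℕ; zero; suc; _≤_)
open import Data.Product.Base using (_×_)
open import Data.Vec.Functional using (Vector; removeAt)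
open import Level using (Level)
open import Relation.Binary.PropositionalEquality.Core using (_≡_)
open import Relation.Nullary.Decidable.Core using (does)

private
  variable
    c ℓ ℓ₁ ℓ₂ : Level
    n : ℕ

------------------------------------------------------------------------
-- Hypergraphs

-- The vertices v₁, …, vₙ are the elements of Fin n.  The edges form a
-- set, so the list enumerating them has no repetitions.

record Hypergraph (n : ℕ) : Set where
  field
    edges  : List (Subset n)
    unique : Unique edges

open Hypergraph public

degree : Hypergraph n → Fin n → ℕ
degree G v = length (filter (v ∈?_) (edges G))

codegree : Hypergraph n → Fin n → Fin n → ℕ
codegree G u v = length (filter (⁅ u ⁆ ∪ ⁅ v ⁆ ⊆?_) (edges G))

-- The standing assumption 2 ≤ k is part of the definition.

Uniform : ℕ → Hypergraph n → Set
Uniform k G = 2 ≤ k × All (λ e → ∣ e ∣ ≡ k) (edges G)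

Regular : ℕ → Hypergraph n → Set
Regular r G = ∀ v → degree G v ≡ r

UniformRegular : ℕ → ℕ → Hypergraph n → Set
UniformRegular k r G = Uniform k G × Regular r G

------------------------------------------------------------------------
-- Square matrices.  Only the ring operations are needed, so that the
-- determinant is available for polynomial entries as well.

module Matrices (R : RawRing c ℓ) where
  open RawRing R
  open RawSemiringDefs rawSemiring using (sum; _^_)

  Matrix : ℕ → Set _
  Matrix n = Fin n → Fin n → Carrier

  identity : Matrix n
  identity i j = if does (i Fin.≟ j) then 1# else 0#

  allOnes : Matrix n
  allOnes i j = 1#

  -- Laplace expansion along the first row.
  det : Matrix n → Carrier
  det {zero}  M = 1#
  det {suc n} M =
    sum λ j → (- 1#) ^ toℕ j * M zero j * det (λ i → removeAt (M (suc i)) j)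

------------------------------------------------------------------------
-- Univariate polynomials.  The list a₀ ∷ a₁ ∷ … stands for
-- a₀ + a₁X + …; trailing zeros are allowed, and equality compares all
-- coefficients.

module Polynomials (R : RawRing c ℓ) where
  open RawRing R

  Poly : Set _
  Poly = List Carrier

  coeff : Poly → ℕ → Carrier
  coeff []      i       = 0#
  coeff (a ∷ p) zero    = a
  coeff (a ∷ p) (suc i) = coeff p i

  infix 4 _≈ₚ_
  _≈ₚ_ : Poly → Poly → Set _
  p ≈ₚ q = ∀ i → coeff p i ≈ coeff q i

  infixl 6 _+ₚ_
  _+ₚ_ : Poly → Poly → Poly
  []      +ₚ q       = q
  (a ∷ p) +ₚ []      = a ∷ p
  (a ∷ p) +ₚ (b ∷ q) = a + b ∷ p +ₚ q

  infixl 7 _*ₚ_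
  _*ₚ_ : Poly → Poly → Poly
  []      *ₚ q = []
  (a ∷ p) *ₚ q = map (a *_) q +ₚ (0# ∷ p *ₚ q)

  infix 8 -ₚ_
  -ₚ_ : Poly → Poly
  -ₚ_ = map (-_)

  infixl 6 _-ₚ_
  _-ₚ_ : Poly → Poly → Poly
  p -ₚ q = p +ₚ (-ₚ q)

  polyRawRing : RawRing _ _
  polyRawRing = record
    { Carrier = Poly
    ; _≈_     = _≈ₚ_
    ; _+_     = _+ₚ_
    ; _*_     = _*ₚ_
    ; -_      = -ₚ_
    ; 0#      = []
    ; 1#      = 1# ∷ []
    }

  C : Carrier → Poly
  C a = a ∷ []

  X : Poly
  X = 0# ∷ 1# ∷ []

------------------------------------------------------------------------
-- Spectra

module Spectra (K : HeytingField c ℓ₁ ℓ₂) where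
  open HeytingField K

  rawRing : RawRing _ _
  rawRing = CommutativeRing.rawRing
    (record { isCommutativeRing = isCommutativeRing })

  open RawSemiringDefs (RawRing.rawSemiring rawRing)
    using () renaming (_×_ to _·_)

  fromℕ : ℕ → Carrier
  fromℕ m = m · 1#

  -- In a Heyting field x # 0# says that x is invertible; this is the
  -- constructive form of "x is nonzero".
  CharacteristicZero : Set _
  CharacteristicZero = ∀ m → fromℕ (suc m) # 0#

  open Matrices rawRing using (Matrix; identity; allOnes)
  open Polynomials rawRing

  private
    module PolyMatrices = Matrices polyRawRing

  open RawSemiringDefs (RawRing.rawSemiring polyRawRing) using (product)

  charPoly : Matrix n → Poly
  charPoly M =
    PolyMatrices.det λ i j → X *ₚ PolyMatrices.identity i j -ₚ C (M i j)

  -- The family μ lists the eigenvalues of M, in some order and with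
  -- algebraic multiplicity: det (XI - M) = ∏ᵢ (X - μᵢ) in K[X].
  HasSpectrum : Matrix n → Vector Carrier n → Set _
  HasSpectrum M μ = charPoly M ≈ₚ product λ i → X -ₚ C (μ i)

  adjacency : Hypergraph n → Matrix n
  adjacency G i j = if does (i Fin.≟ j) then 0# else fromℕ (codegree G i j)

  seidel : Hypergraph n → Matrix n
  seidel G i j = allOnes i j - identity i j - fromℕ 2 * adjacency G i j

{-# OPTIONS --safe #-}

-- A (k,r)-regular hypergraph has constant row sums r(k-1) in A, by double counting.
-- For any matrix B with constant row sums s, adding all columns to the first gives
-- det B = s D, where D is det B with its first column replaced by ones; for B - J the
-- row sums become s - n, and subtracting ones from the other columns does not change D,
-- so det (B - J) = (s - n) D.  Apply this to B = (X+1)I + 2A, for which XI - S = B - J.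
-- Substituting Y = -(X+1)/2 for X in det (XI - A) = ∏ (X - λᵢ) and multiplying by (-2)ⁿ
-- gives det B = ∏ (X + 1 + 2λᵢ).  Its first factor is s, which is monic and can be
-- cancelled, so D is the product of the others.

module Submission where

open import Defs
open import Algebra.Apartness.Bundles using (HeytingField)
open import Algebra.Bundles using (CommutativeMonoid; CommutativeRing; Semiring)
import Algebra.Definitions.RawSemiring as RawSemiringDefs
open import Algebra.Morphism.Structures using (IsRingHomomorphism)
import Algebra.Properties.Ring as RingProperties
import Algebra.Properties.Semiring.Mult as SemiringMult
import Algebra.Properties.Semiring.Sum as SemiringSum
import Algebra.Solver.CommutativeMonoid as CommutativeMonoidSolver
import Algebra.Solver.Ring.NaturalCoefficients.Default as SemiringSolver
open import Data.Bool.Base using (Bool; true; false; if_then_else_)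
open import Data.Fin.Base using (Fin; zero; suc; toℕ; inject₁; punchIn; punchOut)
open import Data.Fin.Induction using (<-weakInduction)
open import Data.Fin.Properties
  using (_≟_; suc-injective; punchInᵢ≢i; punchIn-punchOut; punchIn-injective; toℕ-inject₁)
open import Data.List.Base as List using (List; []; length; filter)
open import Data.Nat.Base as ℕ using (ℕ; zero; suc)
import Data.Nat.Properties as ℕ
open import Data.Product.Base using (∃; _×_; _,_; proj₁; proj₂)
open import Data.Sum.Base using (_⊎_; inj₁; inj₂)
open import Data.Vec.Functional using (Vector; removeAt; tail; updateAt)
open import Data.Vec.Functional.Properties using (updateAt-updates; updateAt-minimal)
open import Function.Base using (_∘_; const)
open import Relation.Binary.PropositionalEquality as ≡ using (_≡_; _≢_)
open import Relation.Nullary.Decidable using (yes; no; does; dec-true; dec-false)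
open import Relation.Nullary.Negation using (contradiction)
open import Relation.Unary using (Pred; Decidable)

-- The spectrum is given only as a factorisation of the characteristic polynomial, over a field
-- whose equality need not be decidable and which carries no inner product. The usual route, a
-- common orthogonal eigenbasis of `A` and `J`, is therefore not at hand, and the argument compares
-- determinants with entries in K[X] instead. The point of D is that it is shared: passing from B to
-- B - J changes the common row sum and nothing else, so D, read off from the known `det B`, can be
-- reused for the Seidel matrix. The polynomial Y solves -2Y = X + 1, which makes -2(YI - A) equal
-- to B; halving is where characteristic zero enters.

-- Identities in a commutative ring

module RingIdentities {c ℓ} (R : CommutativeRing c ℓ) where
  open CommutativeRing R hiding (zero)
  open RingProperties ring
    using (-‿distribˡ-*; -‿involutive; -‿+-comm; x[y-z]≈xy-xz; -0#≈0#)
  open SemiringSum semiring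
    using (sum; sum-replicate-zero; ∑-distrib-+)
  open SemiringMult semiring using (×-homo-+) renaming (_×_ to _·_)
  open RawSemiringDefs (Semiring.rawSemiring semiring) using (product; _^_)
  open SemiringSolver commutativeSemiring using (solve; _:=_; _:+_; _:*_)
  open Matrices rawRing using (identity)
  open import Relation.Binary.Reasoning.Setoid setoid

  product-cong : ∀ {n} {s t : Vector Carrier n} → (∀ i → s i ≈ t i) → product s ≈ product t
  product-cong {zero} s≈t = refl
  product-cong {suc n} s≈t = *-cong (s≈t zero) (product-cong (λ i → s≈t (suc i)))

  product-scale : ∀ {n} a (t : Vector Carrier n) → product (λ i → a * t i) ≈ a ^ n * product t
  product-scale {zero} a t = sym (*-identityˡ 1#)
  product-scale {suc n} a t = trans (*-congˡ (product-scale a (t ∘ suc)))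
    (solve 4 (λ a x b y → (a :* x) :* (b :* y) := (a :* b) :* (x :* y)) refl _ _ _ _)

  sum-neg : ∀ {n} (t : Vector Carrier n) → sum (λ i → - t i) ≈ - sum t
  sum-neg {zero} t = sym -0#≈0#
  sum-neg {suc n} t = trans (+-congˡ (sum-neg (t ∘ suc))) (-‿+-comm _ _)

  sum-difference : ∀ {n} (s t : Vector Carrier n) → sum (λ i → s i - t i) ≈ sum s - sum t
  sum-difference s t = trans (∑-distrib-+ s (λ i → - t i)) (+-congˡ (sum-neg t))

  sum-identity : ∀ {n} (i : Fin n) → sum (identity i) ≈ 1#
  sum-identity {suc n} zero = trans (+-congˡ (sum-replicate-zero n)) (+-identityʳ 1#)
  sum-identity (suc i) = trans (+-identityˡ _) (sum-identity i)

  ·-homo-sum : ∀ {n} (t : Vector ℕ n) →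
    sum (λ i → t i · 1#) ≈ SemiringSum.sum ℕ.+-*-semiring t · 1#
  ·-homo-sum {zero} t = refl
  ·-homo-sum {suc n} t = trans (+-congˡ (·-homo-sum (t ∘ suc))) (sym (×-homo-+ 1# (t zero) _))

  neg-difference : ∀ x y → - (x - y) ≈ - x + y
  neg-difference x y = trans (sym (-‿+-comm x (- y))) (+-congˡ (-‿involutive y))

  module _ {c t x y} (cy≈x+1 : c * y ≈ x + 1#) (c≈-t : c ≈ - t) where

    -- Used with `c` = -2, `t` = 2, `x` = X and `y` = Y: for entries `i` of the identity and `a` of
    -- the adjacency matrix, both sides are the entry of B.
    rescale : ∀ i a → c * (y * i - a) ≈ (x + 1#) * i + t * a
    rescale i a = begin
      c * (y * i - a)         ≈⟨ x[y-z]≈xy-xz c (y * i) a ⟩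
      c * (y * i) - c * a     ≈⟨ +-cong (trans (sym (*-assoc c y i)) (*-congʳ cy≈x+1))
                                   (-‿cong (trans (*-congʳ c≈-t) (sym (-‿distribˡ-* t a)))) ⟩
      (x + 1#) * i - - (t * a) ≈⟨ +-congˡ (-‿involutive _) ⟩
      (x + 1#) * i + t * a    ∎

    rescale-entry : ∀ i a → x * i - (1# - i - t * a) ≈ c * (y * i - a) - 1#
    rescale-entry i a = begin
      x * i - (1# - i - t * a)
        ≈⟨ +-congˡ (trans (neg-difference (1# - i) (t * a)) (+-congʳ (neg-difference 1# i))) ⟩
      x * i + (- 1# + i + t * a)
        -- The semiring solver has no negation, so `- 1#` and `1#` enter it as opaque variables. The
        -- factor in `1# * i` is inserted so that it can collect `(x + 1#) * i`.
        ≈⟨ +-congˡ (+-congʳ (+-congˡ (*-identityˡ i))) ⟨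
      x * i + (- 1# + 1# * i + t * a)
        ≈⟨ solve 5 (λ m u x i b → x :* i :+ (m :+ u :* i :+ b) := (x :+ u) :* i :+ b :+ m)
             refl (- 1#) 1# x i (t * a) ⟩
      (x + 1#) * i + t * a - 1#
        ≈⟨ +-congʳ (rescale i a) ⟨
      c * (y * i - a) - 1# ∎

    rescale-root : ∀ a → c * (y - a) ≈ x - (- 1# - t * a)
    rescale-root a = begin
      c * (y - a)               ≈⟨ *-congˡ (+-congʳ (*-identityʳ y)) ⟨
      c * (y * 1# - a)          ≈⟨ rescale 1# a ⟩
      (x + 1#) * 1# + t * a     ≈⟨ +-congʳ (*-identityʳ _) ⟩
      x + 1# + t * a            ≈⟨ +-assoc x 1# (t * a) ⟩
      x + (1# + t * a)          ≈⟨ +-congˡ (+-congʳ (-‿involutive 1#)) ⟨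
      x + (- - 1# + t * a)      ≈⟨ +-congˡ (neg-difference (- 1#) (t * a)) ⟨
      x - (- 1# - t * a)        ∎

  -- Subtracting J lowers the row sum by n, which raises its root by n. This is the only eigenvalue
  -- that J moves.
  shift-root : ∀ x n b → x - (- 1# - b) - n ≈ x - (n - 1# - b)
  shift-root x n b = begin
    x - (- 1# - b) - n       ≈⟨ +-assoc x _ _ ⟩
    x + (- (- 1# - b) - n)   ≈⟨ +-congˡ (-‿+-comm _ n) ⟩
    x - (- 1# - b + n)       ≈⟨ +-congˡ (-‿cong (trans (+-comm _ n) (sym (+-assoc n (- 1#) (- b))))) ⟩
    x - (n - 1# - b)         ∎

-- Determinants

-- For the Laplace expansion: deleting a column other than two neighbours leaves them neighbours in
-- the minor, at positions `q` and `q + 1`.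
punchIn-adjacent : ∀ {n} (j : Fin (2 ℕ.+ n)) (p : Fin (suc n)) →
  j ≢ inject₁ p → j ≢ suc p →
  ∃ λ q → punchIn j (inject₁ q) ≡ inject₁ p × punchIn j (suc q) ≡ suc p
punchIn-adjacent zero zero j≢p _ = contradiction ≡.refl j≢p
punchIn-adjacent zero (suc p) _ _ = p , ≡.refl , ≡.refl
punchIn-adjacent (suc zero) zero _ j≢p = contradiction ≡.refl j≢p
punchIn-adjacent (suc (suc zero)) zero _ _ = zero , ≡.refl , ≡.refl
punchIn-adjacent (suc (suc (suc j))) zero _ _ = zero , ≡.refl , ≡.refl
punchIn-adjacent {suc n} (suc j) (suc p) j≢p j≢p+1 =
  let q , eq , eq′ = punchIn-adjacent j p (j≢p ∘ ≡.cong suc) (j≢p+1 ∘ ≡.cong suc)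
  in suc q , ≡.cong suc eq , ≡.cong suc eq′

inject₁≢suc : ∀ {n} (i : Fin n) → inject₁ i ≢ suc i
inject₁≢suc (suc i) = inject₁≢suc i ∘ suc-injective

-- Compares the minors that omit one of two neighbouring columns: they differ only where the other
-- one survives, so they agree when the two columns are equal.
punchIn-neighbours : ∀ {n} (p k : Fin n) →
  punchIn (inject₁ p) k ≡ punchIn (suc p) k ⊎
  (punchIn (inject₁ p) k ≡ suc p × punchIn (suc p) k ≡ inject₁ p)
punchIn-neighbours zero zero = inj₂ (≡.refl , ≡.refl)
punchIn-neighbours zero (suc k) = inj₁ ≡.refl
punchIn-neighbours (suc p) zero = inj₁ ≡.refl
punchIn-neighbours (suc p) (suc k) with punchIn-neighbours p k
... | inj₁ eq = inj₁ (≡.cong suc eq)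
... | inj₂ (eq , eq′) = inj₂ (≡.cong suc eq , ≡.cong suc eq′)

module Determinant {c ℓ} (R : CommutativeRing c ℓ) where
  open import Data.List.Base using (_∷_)
  open import Data.List.Membership.Propositional using (_∉_)
  open import Data.List.Membership.Propositional.Properties using (∈-allFin)
  open import Data.List.Relation.Unary.Any using (here; there)
  open CommutativeRing R hiding (zero)
  open RingProperties ring using (-1*x≈-x)
  open SemiringSum semiring
    using (sum; sum-cong-≋; sum-replicate-zero; ∑-distrib-+; *-distribˡ-sum)
  open RawSemiringDefs (Semiring.rawSemiring semiring) using (_^_)
  open SemiringSolver commutativeSemiring using (solve; _:=_; _:+_; _:*_)
  open Matrices rawRing
  open import Relation.Binary.Reasoning.Setoid setoid

  sum-zero : ∀ {n} {t : Vector Carrier n} → (∀ i → t i ≈ 0#) → sum t ≈ 0#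
  sum-zero {n} t≈0 = trans (sum-cong-≋ t≈0) (sum-replicate-zero n)

  sum-adjacent : ∀ {n} (p : Fin n) {t : Vector Carrier (suc n)} →
    t (inject₁ p) + t (suc p) ≈ 0# →
    (∀ j → j ≢ inject₁ p → j ≢ suc p → t j ≈ 0#) → sum t ≈ 0#
  sum-adjacent zero {t} t₀+t₁≈0 rest = begin
    t zero + (t (suc zero) + sum (tail (tail t)))  ≈⟨ +-assoc _ _ _ ⟨
    t zero + t (suc zero) + sum (tail (tail t))
      ≈⟨ +-cong t₀+t₁≈0 (sum-zero (λ i → rest (suc (suc i)) (λ ()) (λ ()))) ⟩
    0# + 0#                                        ≈⟨ +-identityˡ 0# ⟩
    0#                                             ∎
  sum-adjacent (suc p) {t} eq rest = begin
    t zero + sum (tail t)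
      ≈⟨ +-cong (rest zero (λ ()) (λ ()))
                (sum-adjacent p eq λ j j≢p j≢p+1 →
                  rest (suc j) (j≢p ∘ suc-injective) (j≢p+1 ∘ suc-injective)) ⟩
    0# + 0#                ≈⟨ +-identityˡ 0# ⟩
    0#                     ∎

  private
    minor : ∀ {n} → Matrix (suc n) → Fin (suc n) → Matrix n
    minor M j i = removeAt (M (suc i)) j

    cofactorTerm : ∀ {n} → Matrix (suc n) → Fin (suc n) → Carrier
    cofactorTerm M j = (- 1#) ^ toℕ j * M zero j * det (minor M j)

  det-cong : ∀ {n} {M N : Matrix n} → (∀ i j → M i j ≈ N i j) → det M ≈ det N
  det-cong {zero} M≈N = refl
  det-cong {suc n} M≈N = sum-cong-≋ λ j →
    *-cong (*-congˡ {(- 1#) ^ toℕ j} (M≈N zero j)) (det-cong λ i k → M≈N (suc i) (punchIn j k))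

  det-scale : ∀ {n} a (M : Matrix n) → det (λ i j → a * M i j) ≈ a ^ n * det M
  det-scale {zero} a M = sym (*-identityˡ 1#)
  det-scale {suc n} a M = trans
    (sum-cong-≋ λ j → begin
      (- 1#) ^ toℕ j * (a * M zero j) * det (λ i k → a * minor M j i k)
        ≈⟨ *-congˡ (det-scale a (minor M j)) ⟩
      (- 1#) ^ toℕ j * (a * M zero j) * (a ^ n * det (minor M j))
        ≈⟨ solve 5 (λ e a m b d → e :* (a :* m) :* (b :* d) := a :* b :* (e :* m :* d))
             refl _ _ _ _ _ ⟩
      a ^ suc n * cofactorTerm M j ∎)
    (sym (*-distribˡ-sum _ (cofactorTerm M)))

  -- Linearity holds term by term in the Laplace expansion. In term `p` the top entry splits and the
  -- minors coincide; in any other term the top entries coincide and the minor is linear in column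
  -- `punchOut j≢p`, where column `p` lands. Two free coefficients give additivity, scaling and the
  -- zero column at once.
  det-linear : ∀ {n} (p : Fin n) a b {L M N : Matrix n} →
    (∀ i → L i p ≈ a * M i p + b * N i p) →
    (∀ i {k} → k ≢ p → L i k ≈ M i k) → (∀ i {k} → k ≢ p → L i k ≈ N i k) →
    det L ≈ a * det M + b * det N
  det-linear {suc n} p a b {L} {M} {N} atp L≈M L≈N = begin
    sum (cofactorTerm L)
      ≈⟨ sum-cong-≋ term ⟩
    sum (λ j → a * cofactorTerm M j + b * cofactorTerm N j)
      ≈⟨ ∑-distrib-+ (λ j → a * cofactorTerm M j) (λ j → b * cofactorTerm N j) ⟩
    sum (λ j → a * cofactorTerm M j) + sum (λ j → b * cofactorTerm N j)
      ≈⟨ +-cong (*-distribˡ-sum a (cofactorTerm M)) (*-distribˡ-sum b (cofactorTerm N)) ⟨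
    a * det M + b * det N ∎
    where
    term : ∀ j → cofactorTerm L j ≈ a * cofactorTerm M j + b * cofactorTerm N j
    term j with j ≟ p
    ... | yes ≡.refl = begin
      e * L zero j * det (minor L j)
        ≈⟨ *-congʳ (*-congˡ (atp zero)) ⟩
      e * (a * M zero j + b * N zero j) * det (minor L j)
        ≈⟨ solve 6 (λ e a m b n d → e :* (a :* m :+ b :* n) :* d
                                   := a :* (e :* m :* d) :+ b :* (e :* n :* d))
             refl e a _ b _ _ ⟩
      a * (e * M zero j * det (minor L j)) + b * (e * N zero j * det (minor L j))
        ≈⟨ +-cong (*-congˡ (*-congˡ (det-cong λ i k → L≈M (suc i) (punchInᵢ≢i j k))))
                  (*-congˡ (*-congˡ (det-cong λ i k → L≈N (suc i) (punchInᵢ≢i j k)))) ⟩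
      a * cofactorTerm M j + b * cofactorTerm N j ∎
      where e = (- 1#) ^ toℕ j
    ... | no j≢p = begin
      e * L zero j * det (minor L j)
        ≈⟨ *-congˡ (det-linear q a b (λ i → atq (suc i))
             (λ i k≢q → L≈M (suc i) (off k≢q)) (λ i k≢q → L≈N (suc i) (off k≢q))) ⟩
      e * L zero j * (a * det (minor M j) + b * det (minor N j))
        ≈⟨ solve 6 (λ e l a m b n → e :* l :* (a :* m :+ b :* n)
                                   := a :* (e :* l :* m) :+ b :* (e :* l :* n))
             refl e _ a _ b _ ⟩
      a * (e * L zero j * det (minor M j)) + b * (e * L zero j * det (minor N j))
        ≈⟨ +-cong (*-congˡ (*-congʳ (*-congˡ (L≈M zero j≢p))))
                  (*-congˡ (*-congʳ (*-congˡ (L≈N zero j≢p)))) ⟩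
      a * cofactorTerm M j + b * cofactorTerm N j ∎
      where
      e = (- 1#) ^ toℕ j
      q = punchOut j≢p
      jq≡p = punchIn-punchOut j≢p
      atq : ∀ i → L i (punchIn j q) ≈ a * M i (punchIn j q) + b * N i (punchIn j q)
      atq i rewrite jq≡p = atp i
      off : ∀ {k} → k ≢ q → punchIn j k ≢ p
      off k≢q jk≡p = k≢q (punchIn-injective j _ _ (≡.trans jk≡p (≡.sym jq≡p)))

  -- In the expansion, terms `p` and `p + 1` have equal entries and equal minors but opposite signs.
  -- Every other minor still contains both columns, side by side, and vanishes by induction on the
  -- size.
  det-adjacent : ∀ {n} (p : Fin n) {M : Matrix (suc n)} →
    (∀ i → M i (inject₁ p) ≈ M i (suc p)) → det M ≈ 0#
  det-adjacent {suc n} p {M} eq = sum-adjacent p cancel vanish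
    where
    minors : ∀ i k → minor M (inject₁ p) i k ≈ minor M (suc p) i k
    minors i k with punchIn-neighbours p k
    ... | inj₁ same rewrite same = refl
    ... | inj₂ (l , r) rewrite l | r = sym (eq (suc i))

    cancel : cofactorTerm M (inject₁ p) + cofactorTerm M (suc p) ≈ 0#
    -- After the rewrite the two signs are `e` and `- 1# * e` for the same power `e`.
    cancel rewrite toℕ-inject₁ p = begin
      e * M zero (inject₁ p) * det (minor M (inject₁ p)) + - 1# * e * m * d
        ≈⟨ +-cong (*-cong (*-congˡ (eq zero)) (det-cong minors)) (begin
             - 1# * e * m * d
               ≈⟨ solve 4 (λ o e m d → o :* e :* m :* d := o :* (e :* m :* d)) refl _ e m d ⟩
             - 1# * (e * m * d)     ≈⟨ -1*x≈-x _ ⟩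
             - (e * m * d)          ∎) ⟩
      e * m * d - e * m * d ≈⟨ -‿inverseʳ _ ⟩
      0# ∎
      where
      e = (- 1#) ^ toℕ p
      m = M zero (suc p)
      d = det (minor M (suc p))

    vanish : ∀ j → j ≢ inject₁ p → j ≢ suc p → cofactorTerm M j ≈ 0#
    vanish j j≢p j≢p+1 = trans (*-congˡ (det-adjacent q {minor M j} (λ i → columns (suc i)))) (zeroʳ _)
      where
      adj = punchIn-adjacent j p j≢p j≢p+1
      q = proj₁ adj
      columns : ∀ i → M i (punchIn j (inject₁ q)) ≈ M i (punchIn j (suc q))
      columns i rewrite proj₁ (proj₂ adj) | proj₂ (proj₂ adj) = eq i

  withColumn : ∀ {n} → Matrix n → Fin n → Vector Carrier n → Matrix n
  withColumn M p v i = updateAt (M i) p (const (v i))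

  withColumn-at : ∀ {n} (M : Matrix n) p v i → withColumn M p v i p ≈ v i
  withColumn-at M p v i = reflexive (updateAt-updates p (M i))

  withColumn-off : ∀ {n} (M : Matrix n) p v i {k} → k ≢ p → withColumn M p v i k ≈ M i k
  withColumn-off M p v i k≢p = reflexive (updateAt-minimal _ p (M i) k≢p)

  withColumn-self : ∀ {n} (M : Matrix n) p {v} → (∀ i → v i ≈ M i p) →
    det (withColumn M p v) ≈ det M
  withColumn-self M p {v} v≈ = det-cong {M = withColumn M p v} entry
    where
    entry : ∀ i j → withColumn M p v i j ≈ M i j
    entry i j with j ≟ p
    ... | yes ≡.refl = trans (withColumn-at M p v i) (v≈ i)
    ... | no j≢p = withColumn-off M p v i j≢p

  det-withColumn-linear : ∀ {n} (M : Matrix n) p a b {u v w} →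
    (∀ i → u i ≈ a * v i + b * w i) →
    det (withColumn M p u) ≈ a * det (withColumn M p v) + b * det (withColumn M p w)
  det-withColumn-linear M p a b {u} {v} {w} u≈ = det-linear p a b
    (λ i → trans (withColumn-at M p u i) (trans (u≈ i) (sym
       (+-cong (*-congˡ (withColumn-at M p v i)) (*-congˡ (withColumn-at M p w i))))))
    (λ i k≢p → trans (withColumn-off M p u i k≢p) (sym (withColumn-off M p v i k≢p)))
    (λ i k≢p → trans (withColumn-off M p u i k≢p) (sym (withColumn-off M p w i k≢p)))

  det-withColumn-+ : ∀ {n} (M : Matrix n) p v w →
    det (withColumn M p (λ i → v i + w i)) ≈ det (withColumn M p v) + det (withColumn M p w)
  det-withColumn-+ M p v w = trans
    (det-withColumn-linear M p 1# 1# λ i → sym (+-cong (*-identityˡ _) (*-identityˡ _)))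
    (+-cong (*-identityˡ _) (*-identityˡ _))

  det-withColumn-scale : ∀ {n} (M : Matrix n) p a v →
    det (withColumn M p (λ i → a * v i)) ≈ a * det (withColumn M p v)
  det-withColumn-scale M p a v = trans
    (det-withColumn-linear M p a 0# {w = v} λ i →
      sym (trans (+-congˡ (zeroˡ _)) (+-identityʳ _)))
    (trans (+-congˡ (zeroˡ _)) (+-identityʳ _))

  det-withColumn-sum : ∀ {n k} (M : Matrix n) p (v : Fin k → Vector Carrier n) →
    det (withColumn M p (λ i → sum (λ j → v j i))) ≈ sum (λ j → det (withColumn M p (v j)))
  -- The empty sum is the zero column, a combination of two columns with both coefficients zero.
  det-withColumn-sum {k = zero} M p v = trans
    (det-withColumn-linear M p 0# 0# {v = λ _ → 0#} {w = λ _ → 0#} λ i →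
      sym (trans (+-cong (zeroˡ _) (zeroˡ _)) (+-identityˡ 0#)))
    (trans (+-cong (zeroˡ _) (zeroˡ _)) (+-identityˡ 0#))
  det-withColumn-sum {k = suc k} M p v = trans
    (det-withColumn-+ M p (v zero) _)
    (+-congˡ (det-withColumn-sum M p (λ j → v (suc j))))

  -- Induction on the position of the second copy: if a and b are the columns at
  -- two adjacent positions p and p+1, and b is the first column, then
  -- |…a,b…| = |…a,a+b…| = |…a+b,a+b…| = 0.
  det-repeated : ∀ {n} (p : Fin n) {M : Matrix (suc n)} →
    (∀ i → M i zero ≈ M i (suc p)) → det M ≈ 0#
  det-repeated {suc n} = <-weakInduction P (λ {M} eq → det-adjacent zero {M} eq) step
    where
    P : Fin (suc n) → Set _
    P p = ∀ {M : Matrix (2 ℕ.+ n)} → (∀ i → M i zero ≈ M i (suc p)) → det M ≈ 0#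

    step : ∀ p → P (inject₁ p) → P (suc p)
    step p ih {M} eq = begin
      det M             ≈⟨ +-identityʳ _ ⟨
      det M + 0#        ≈⟨ +-cong (withColumn-self M s (λ i → refl))
                                  (det-adjacent (suc p) {withColumn M s a} equal-a) ⟨
      det (withColumn M s b) + det (withColumn M s a)
                        ≈⟨ det-withColumn-+ M s b a ⟨
      det N             ≈⟨ +-identityʳ _ ⟨
      det N + 0#        ≈⟨ +-cong (withColumn-self N q λ i → sym (withColumn-off M s b+a i q≢s))
                                  (ih {withColumn N q b} equal-b) ⟨
      det (withColumn N q a) + det (withColumn N q b)
                        ≈⟨ det-withColumn-+ N q a b ⟨
      det (withColumn N q a+b)
                        ≈⟨ det-adjacent (suc p) {withColumn N q a+b} equal-a+b ⟩
      0#                ∎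
      where
      q s : Fin (2 ℕ.+ n)
      q = inject₁ (suc p)
      s = suc (suc p)
      q≢s : q ≢ s
      q≢s = inject₁≢suc (suc p)
      a b a+b b+a : Vector Carrier (2 ℕ.+ n)
      a i = M i q
      b i = M i s
      a+b i = a i + b i
      b+a i = b i + a i
      N = withColumn M s b+a

      equal-a : ∀ i → withColumn M s a i q ≈ withColumn M s a i s
      equal-a i = trans (withColumn-off M s a i q≢s) (sym (withColumn-at M s a i))

      equal-b : ∀ i → withColumn N q b i zero ≈ withColumn N q b i q
      equal-b i = begin
        M i zero                ≈⟨ eq i ⟩
        b i                     ≈⟨ withColumn-at N q b i ⟨
        withColumn N q b i q    ∎

      equal-a+b : ∀ i → withColumn N q a+b i q ≈ withColumn N q a+b i s
      equal-a+b i = begin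
        withColumn N q a+b i q  ≈⟨ withColumn-at N q a+b i ⟩
        a i + b i               ≈⟨ +-comm _ _ ⟩
        b i + a i               ≈⟨ withColumn-at M s b+a i ⟨
        N i s                   ≈⟨ withColumn-off N q a+b i (q≢s ∘ ≡.sym) ⟨
        withColumn N q a+b i s  ∎

  withOnes : ∀ {n} → Matrix (suc n) → Matrix (suc n)
  withOnes M = withColumn M zero (λ _ → 1#)

  -- Put the vector of row sums in the first column. By linearity the determinant splits into one
  -- summand per column of `M`: the first is `det M`, and each of the others repeats a column. The
  -- same vector is also `s` times the column of ones.
  det-constantRowSum : ∀ {n} (M : Matrix (suc n)) s → (∀ i → sum (M i) ≈ s) →
    det M ≈ s * det (withOnes M)
  det-constantRowSum M s rows = begin
    det M                    ≈⟨ +-identityʳ _ ⟨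
    det M + 0#
      ≈⟨ +-cong (withColumn-self M zero (λ i → refl))
                (sum-zero λ j → det-repeated j {withColumn M zero (column (suc j))} λ i → refl) ⟨
    sum (λ j → det (withColumn M zero (column j)))
      ≈⟨ det-withColumn-sum M zero column ⟨
    det (withColumn M zero (λ i → sum (M i)))
      ≈⟨ det-cong {M = withColumn M zero (λ i → sum (M i))} {withColumn M zero (λ i → s * 1#)}
           (λ i → λ { zero → trans (rows i) (sym (*-identityʳ s)) ; (suc j) → refl }) ⟩
    det (withColumn M zero (λ i → s * 1#))
      ≈⟨ det-withColumn-scale M zero s (λ _ → 1#) ⟩
    s * det (withOnes M)     ∎
    where
    column : Fin _ → Vector Carrier _
    column j i = M i j

  -- The list holds the columns still allowed to differ, so induction on it turns `M` into `N` one
  -- column at a time. The first column never changes and remains available as the summand.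
  det-addFirst : ∀ {n} (ps : List (Fin n)) {M N : Matrix (suc n)} →
    (∀ i → N i zero ≈ M i zero) →
    (∀ j → ∃ λ y → ∀ i → N i (suc j) ≈ M i (suc j) + y * M i zero) →
    (∀ {j} → j ∉ ps → ∀ i → N i (suc j) ≈ M i (suc j)) →
    det N ≈ det M
  det-addFirst [] {M} {N} first multiple same = det-cong {M = N} {M} λ i → λ
    { zero → first i
    ; (suc j) → same (λ ()) i }
  det-addFirst {n} (p ∷ ps) {M} {N} first multiple same = begin
    det N  ≈⟨ det-addFirst ps {M′} {N} first multiple′ same′ ⟩
    det M′
      ≈⟨ det-withColumn-linear M q 1# y (λ i → trans (N≈ i) (+-congʳ (sym (*-identityˡ _)))) ⟩
    1# * det (withColumn M q (λ i → M i q)) + y * det (withColumn M q u)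
      ≈⟨ +-cong (trans (*-identityˡ _) (withColumn-self M q (λ i → refl)))
                (trans (*-congˡ (det-repeated p {withColumn M q u} λ i →
                                   sym (withColumn-at M q u i)))
                       (zeroʳ y)) ⟩
    det M + 0# ≈⟨ +-identityʳ _ ⟩
    det M ∎
    where
    y = proj₁ (multiple p)
    N≈ = proj₂ (multiple p)
    q : Fin (suc n)
    q = suc p
    u v : Vector Carrier (suc n)
    u i = M i zero
    v i = N i q
    M′ = withColumn M q v

    multiple′ : ∀ j → ∃ λ y → ∀ i → N i (suc j) ≈ M′ i (suc j) + y * M′ i zero
    multiple′ j with j ≟ p
    -- Column `p` of `M′` is already that of `N`, so its multiplier drops to zero.
    ... | yes ≡.refl = 0# , λ i →
      sym (trans (+-cong (withColumn-at M q v i) (zeroˡ _)) (+-identityʳ _))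
    ... | no j≢p = proj₁ (multiple j) , λ i →
      trans (proj₂ (multiple j) i)
            (+-congʳ (sym (withColumn-off M q v i (j≢p ∘ suc-injective))))

    same′ : ∀ {j} → j ∉ ps → ∀ i → N i (suc j) ≈ M′ i (suc j)
    same′ {j} j∉ps i with j ≟ p
    ... | yes ≡.refl = sym (withColumn-at M q v i)
    ... | no j≢p = trans
      (same (λ { (here j≡p) → j≢p j≡p ; (there j∈ps) → j∉ps j∈ps }) i)
      (sym (withColumn-off M q v i (j≢p ∘ suc-injective)))

  det-withOnes-subtractOnes : ∀ {n} (M : Matrix (suc n)) →
    det (withOnes (λ i j → M i j - 1#)) ≈ det (withOnes M)
  det-withOnes-subtractOnes M = det-addFirst
    (List.allFin _) {withOnes M} {withOnes (λ i j → M i j - 1#)}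
    (λ i → refl)
    (λ j → - 1# , λ i → +-congˡ (sym (*-identityʳ _)))
    -- Every column is listed, so the condition on unlisted ones is vacuous.
    (λ j∉ → contradiction (∈-allFin _) j∉)

-- Ring homomorphisms applied to sums, products and determinants

module _ {c₁ ℓ₁ c₂ ℓ₂} (R : CommutativeRing c₁ ℓ₁) (S : CommutativeRing c₂ ℓ₂)
  {⟦_⟧ : CommutativeRing.Carrier R → CommutativeRing.Carrier S}
  (isHom : IsRingHomomorphism (CommutativeRing.rawRing R) (CommutativeRing.rawRing S) ⟦_⟧) where

  private
    module R where
      open CommutativeRing R public
      open RawSemiringDefs (Semiring.rawSemiring semiring) using (sum; product; _^_) public
      open Matrices rawRing public
    module S = Matrices (CommutativeRing.rawRing S)
  open CommutativeRing S hiding (zero)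
  open RawSemiringDefs (Semiring.rawSemiring semiring) using (sum; product; _^_)
  open IsRingHomomorphism isHom
  open SemiringSum semiring using (sum-cong-≋)
  open import Relation.Binary.Reasoning.Setoid setoid

  sum-homo : ∀ {n} (t : Vector R.Carrier n) → ⟦ R.sum t ⟧ ≈ sum (λ i → ⟦ t i ⟧)
  sum-homo {zero} t = 0#-homo
  sum-homo {suc n} t = trans (+-homo _ _) (+-congˡ (sum-homo (t ∘ suc)))

  product-homo : ∀ {n} (t : Vector R.Carrier n) → ⟦ R.product t ⟧ ≈ product (λ i → ⟦ t i ⟧)
  product-homo {zero} t = 1#-homo
  product-homo {suc n} t = trans (*-homo _ _) (*-congˡ (product-homo (t ∘ suc)))

  sign-homo : ∀ n → ⟦ (R.- R.1#) R.^ n ⟧ ≈ (- 1#) ^ n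
  sign-homo zero = 1#-homo
  sign-homo (suc n) = trans (*-homo _ _) (*-cong (trans (-‿homo _) (-‿cong 1#-homo)) (sign-homo n))

  det-homo : ∀ {n} (M : R.Matrix n) → ⟦ R.det M ⟧ ≈ S.det (λ i j → ⟦ M i j ⟧)
  det-homo {zero} M = 1#-homo
  det-homo {suc n} M = trans (sum-homo λ j → sign j R.* M zero j R.* R.det (minor j))
    (sum-cong-≋ λ j → begin
    ⟦ sign j R.* M zero j R.* R.det (minor j) ⟧
      ≈⟨ trans (*-homo _ _) (*-congʳ (*-homo _ _)) ⟩
    ⟦ sign j ⟧ * ⟦ M zero j ⟧ * ⟦ R.det (minor j) ⟧
      ≈⟨ *-cong (*-congʳ (sign-homo (toℕ j))) (det-homo (minor j)) ⟩
    (- 1#) ^ toℕ j * ⟦ M zero j ⟧ * S.det (λ i k → ⟦ minor j i k ⟧) ∎)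
    where
    sign : Fin (suc n) → R.Carrier
    sign j = (R.- R.1#) R.^ toℕ j
    minor : Fin (suc n) → R.Matrix n
    minor j i = removeAt (M (suc i)) j

-- The polynomial ring

module PolynomialRing {c ℓ} (R : CommutativeRing c ℓ) where
  open CommutativeRing R hiding (zero)
  open RingProperties ring using (-0#≈0#)
  open import Data.List.Base using (_∷_)
  open Polynomials rawRing

  coeff-+ : ∀ p q i → coeff (p +ₚ q) i ≈ coeff p i + coeff q i
  coeff-+ [] q i = sym (+-identityˡ _)
  coeff-+ (a ∷ p) [] i = sym (+-identityʳ _)
  coeff-+ (a ∷ p) (b ∷ q) zero = refl
  coeff-+ (a ∷ p) (b ∷ q) (suc i) = coeff-+ p q i

  coeff-map : ∀ {f} → f 0# ≈ 0# → ∀ p i → coeff (List.map f p) i ≈ f (coeff p i)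
  coeff-map f0≈0 [] i = sym f0≈0
  coeff-map f0≈0 (a ∷ p) zero = refl
  coeff-map f0≈0 (a ∷ p) (suc i) = coeff-map f0≈0 p i

  infixr 7 _·ₚ_
  _·ₚ_ : Carrier → Poly → Poly
  a ·ₚ p = List.map (a *_) p

  coeff-· : ∀ a p i → coeff (a ·ₚ p) i ≈ a * coeff p i
  coeff-· a = coeff-map (zeroʳ a)

  coeff-neg : ∀ p i → coeff (-ₚ p) i ≈ - coeff p i
  coeff-neg = coeff-map -0#≈0#

  -- Unlike p ≈ₚ q, which unfolds to a function type, p ≋ q determines p and q,
  -- so the implicit arguments of the lemmas below can be inferred.
  infix 4 _≋_
  record _≋_ (p q : Poly) : Set ℓ where
    constructor coeffwise
    field coeffs : p ≈ₚ q
  open _≋_ public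

  ∷-cong : ∀ {a b p q} → a ≈ b → p ≋ q → a ∷ p ≋ b ∷ q
  ∷-cong a≈b p≋q = coeffwise λ { zero → a≈b ; (suc i) → coeffs p≋q i }

  ∷-congˡ : ∀ {a p q} → p ≋ q → a ∷ p ≋ a ∷ q
  ∷-congˡ = ∷-cong refl

  +ₚ-cong : ∀ {p p′ q q′} → p ≋ p′ → q ≋ q′ → p +ₚ q ≋ p′ +ₚ q′
  +ₚ-cong {p} {p′} {q} {q′} p≋ q≋ = coeffwise λ i →
    trans (coeff-+ p q i) (trans (+-cong (coeffs p≋ i) (coeffs q≋ i)) (sym (coeff-+ p′ q′ i)))

  -ₚ-cong : ∀ {p q} → p ≋ q → -ₚ p ≋ -ₚ q
  -ₚ-cong {p} {q} p≋q = coeffwise λ i →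
    trans (coeff-neg p i) (trans (-‿cong (coeffs p≋q i)) (sym (coeff-neg q i)))

  ·ₚ-congˡ : ∀ {a p q} → p ≋ q → a ·ₚ p ≋ a ·ₚ q
  ·ₚ-congˡ {a} {p} {q} p≋q = coeffwise λ i →
    trans (coeff-· a p i) (trans (*-congˡ (coeffs p≋q i)) (sym (coeff-· a q i)))

  +ₚ-assoc : ∀ p q r → (p +ₚ q) +ₚ r ≋ p +ₚ (q +ₚ r)
  +ₚ-assoc p q r = coeffwise λ i → begin
    coeff ((p +ₚ q) +ₚ r) i             ≈⟨ coeff-+ (p +ₚ q) r i ⟩
    coeff (p +ₚ q) i + coeff r i        ≈⟨ +-congʳ (coeff-+ p q i) ⟩
    coeff p i + coeff q i + coeff r i   ≈⟨ +-assoc _ _ _ ⟩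
    coeff p i + (coeff q i + coeff r i) ≈⟨ +-congˡ (coeff-+ q r i) ⟨
    coeff p i + coeff (q +ₚ r) i        ≈⟨ coeff-+ p (q +ₚ r) i ⟨
    coeff (p +ₚ (q +ₚ r)) i             ∎
    where open import Relation.Binary.Reasoning.Setoid setoid

  +ₚ-comm : ∀ p q → p +ₚ q ≋ q +ₚ p
  +ₚ-comm p q = coeffwise λ i → trans (coeff-+ p q i) (trans (+-comm _ _) (sym (coeff-+ q p i)))

  +ₚ-identityʳ : ∀ p → p +ₚ [] ≋ p
  +ₚ-identityʳ p = coeffwise λ i → trans (coeff-+ p [] i) (+-identityʳ _)

  -ₚ-inverseʳ : ∀ p → p +ₚ (-ₚ p) ≋ []
  -ₚ-inverseʳ p = coeffwise λ i →
    trans (coeff-+ p (-ₚ p) i) (trans (+-congˡ (coeff-neg p i)) (-‿inverseʳ _))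

  -- Bundled ahead of multiplication, because the multiplicative laws below use its setoid reasoning
  -- and the monoid solver.
  +ₚ-commutativeMonoid : CommutativeMonoid _ _
  +ₚ-commutativeMonoid = record
    { Carrier = Poly ; _≈_ = _≋_ ; _∙_ = _+ₚ_ ; ε = []
    ; isCommutativeMonoid = record
      { isMonoid = record
        { isSemigroup = record
          { isMagma = record
            { isEquivalence = record
              { refl  = coeffwise λ i → refl
              ; sym   = λ p≋q → coeffwise λ i → sym (coeffs p≋q i)
              ; trans = λ p≋q q≋r → coeffwise λ i → trans (coeffs p≋q i) (coeffs q≋r i)
              }
            ; ∙-cong = +ₚ-cong
            }
          ; assoc = +ₚ-assoc
          }
        ; identity = (λ p → coeffwise λ i → refl) , +ₚ-identityʳ
        }
      ; comm = +ₚ-comm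
      }
    }

  private
    module P = CommutativeMonoid +ₚ-commutativeMonoid
  open import Relation.Binary.Reasoning.Setoid P.setoid
  open CommutativeMonoidSolver +ₚ-commutativeMonoid
    using () renaming (solve to solveₚ; _⊕_ to _:⊕_; _⊜_ to _:≈_)

  0∷-+ : ∀ p q → 0# ∷ p +ₚ q ≋ (0# ∷ p) +ₚ (0# ∷ q)
  0∷-+ p q = ∷-cong (sym (+-identityˡ 0#)) P.refl

  0∷[]≋[] : 0# ∷ [] ≋ []
  0∷[]≋[] = coeffwise λ { zero → refl ; (suc i) → refl }

  ·ₚ-distrib-+ₚ : ∀ a p q → a ·ₚ (p +ₚ q) ≋ a ·ₚ p +ₚ a ·ₚ q
  ·ₚ-distrib-+ₚ a [] q = P.refl
  ·ₚ-distrib-+ₚ a (b ∷ p) [] = P.refl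
  ·ₚ-distrib-+ₚ a (b ∷ p) (c ∷ q) = ∷-cong (distribˡ a b c) (·ₚ-distrib-+ₚ a p q)

  ·ₚ-·ₚ : ∀ a b p → a ·ₚ b ·ₚ p ≋ (a * b) ·ₚ p
  ·ₚ-·ₚ a b [] = P.refl
  ·ₚ-·ₚ a b (c ∷ p) = ∷-cong (sym (*-assoc a b c)) (·ₚ-·ₚ a b p)

  1·ₚ : ∀ p → 1# ·ₚ p ≋ p
  1·ₚ p = coeffwise λ i → trans (coeff-· 1# p i) (*-identityˡ _)

  0·ₚ : ∀ p → 0# ·ₚ p ≋ []
  0·ₚ p = coeffwise λ i → trans (coeff-· 0# p i) (zeroˡ _)

  *ₚ-congˡ : ∀ p {q q′} → q ≋ q′ → p *ₚ q ≋ p *ₚ q′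
  *ₚ-congˡ [] q≋ = P.refl
  *ₚ-congˡ (a ∷ p) q≋ = +ₚ-cong (·ₚ-congˡ q≋) (∷-congˡ (*ₚ-congˡ p q≋))

  *ₚ-zeroʳ : ∀ p → p *ₚ [] ≋ []
  *ₚ-zeroʳ [] = P.refl
  *ₚ-zeroʳ (a ∷ p) = P.trans (∷-congˡ (*ₚ-zeroʳ p)) 0∷[]≋[]

  -- Mirrors the defining clause of `*ₚ` in the second argument, which makes commutativity an
  -- induction.
  *ₚ-∷ : ∀ p b q → p *ₚ (b ∷ q) ≋ b ·ₚ p +ₚ (0# ∷ p *ₚ q)
  *ₚ-∷ [] b q = P.sym 0∷[]≋[]
  *ₚ-∷ (a ∷ p) b q = ∷-cong (+-congʳ (*-comm a b)) (begin
    a ·ₚ q +ₚ p *ₚ (b ∷ q)                ≈⟨ P.∙-congˡ (*ₚ-∷ p b q) ⟩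
    a ·ₚ q +ₚ (b ·ₚ p +ₚ (0# ∷ p *ₚ q))
      ≈⟨ solveₚ 3 (λ x y z → (x :⊕ (y :⊕ z)) :≈ (y :⊕ (x :⊕ z))) P.refl
           (a ·ₚ q) (b ·ₚ p) (0# ∷ p *ₚ q) ⟩
    b ·ₚ p +ₚ (a ·ₚ q +ₚ (0# ∷ p *ₚ q))   ∎)

  *ₚ-comm : ∀ p q → p *ₚ q ≋ q *ₚ p
  *ₚ-comm [] q = P.sym (*ₚ-zeroʳ q)
  *ₚ-comm (a ∷ p) q = P.trans (P.∙-congˡ (∷-congˡ (*ₚ-comm p q))) (P.sym (*ₚ-∷ q a p))

  *ₚ-distribˡ : ∀ p q r → p *ₚ (q +ₚ r) ≋ p *ₚ q +ₚ p *ₚ r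
  *ₚ-distribˡ [] q r = P.refl
  *ₚ-distribˡ (a ∷ p) q r = begin
    a ·ₚ (q +ₚ r) +ₚ (0# ∷ p *ₚ (q +ₚ r))
      ≈⟨ +ₚ-cong (·ₚ-distrib-+ₚ a q r)
           (P.trans (∷-congˡ (*ₚ-distribˡ p q r)) (0∷-+ (p *ₚ q) (p *ₚ r))) ⟩
    (a ·ₚ q +ₚ a ·ₚ r) +ₚ ((0# ∷ p *ₚ q) +ₚ (0# ∷ p *ₚ r))
      ≈⟨ solveₚ 4 (λ x y z w → ((x :⊕ y) :⊕ (z :⊕ w)) :≈ ((x :⊕ z) :⊕ (y :⊕ w))) P.refl
           (a ·ₚ q) (a ·ₚ r) (0# ∷ p *ₚ q) (0# ∷ p *ₚ r) ⟩
    (a ·ₚ q +ₚ (0# ∷ p *ₚ q)) +ₚ (a ·ₚ r +ₚ (0# ∷ p *ₚ r)) ∎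

  -- Multiplication recurses on its first argument, where equal polynomials may be lists of
  -- different length; commutativity moves that argument to the side where congruence is easy.
  *ₚ-cong : ∀ {p p′ q q′} → p ≋ p′ → q ≋ q′ → p *ₚ q ≋ p′ *ₚ q′
  *ₚ-cong {p} {p′} {q} {q′} p≋ q≋ = begin
    p *ₚ q   ≈⟨ *ₚ-congˡ p q≋ ⟩
    p *ₚ q′  ≈⟨ *ₚ-comm p q′ ⟩
    q′ *ₚ p  ≈⟨ *ₚ-congˡ q′ p≋ ⟩
    q′ *ₚ p′ ≈⟨ *ₚ-comm q′ p′ ⟩
    p′ *ₚ q′ ∎

  *ₚ-distribʳ : ∀ p q r → (q +ₚ r) *ₚ p ≋ q *ₚ p +ₚ r *ₚ p
  *ₚ-distribʳ p q r = begin
    (q +ₚ r) *ₚ p      ≈⟨ *ₚ-comm (q +ₚ r) p ⟩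
    p *ₚ (q +ₚ r)      ≈⟨ *ₚ-distribˡ p q r ⟩
    p *ₚ q +ₚ p *ₚ r   ≈⟨ +ₚ-cong (*ₚ-comm p q) (*ₚ-comm p r) ⟩
    q *ₚ p +ₚ r *ₚ p   ∎

  ·ₚ-*ₚ : ∀ a p q → (a ·ₚ p) *ₚ q ≋ a ·ₚ (p *ₚ q)
  ·ₚ-*ₚ a [] q = P.refl
  ·ₚ-*ₚ a (b ∷ p) q = begin
    (a * b) ·ₚ q +ₚ (0# ∷ (a ·ₚ p) *ₚ q)
      ≈⟨ +ₚ-cong (P.sym (·ₚ-·ₚ a b q)) (∷-cong (sym (zeroʳ a)) (·ₚ-*ₚ a p q)) ⟩
    a ·ₚ b ·ₚ q +ₚ a ·ₚ (0# ∷ p *ₚ q)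
      ≈⟨ ·ₚ-distrib-+ₚ a (b ·ₚ q) (0# ∷ p *ₚ q) ⟨
    a ·ₚ (b ·ₚ q +ₚ (0# ∷ p *ₚ q)) ∎

  *ₚ-assoc : ∀ p q r → (p *ₚ q) *ₚ r ≋ p *ₚ (q *ₚ r)
  *ₚ-assoc [] q r = P.refl
  *ₚ-assoc (a ∷ p) q r = begin
    (a ·ₚ q +ₚ (0# ∷ p *ₚ q)) *ₚ r
      ≈⟨ *ₚ-distribʳ r (a ·ₚ q) (0# ∷ p *ₚ q) ⟩
    (a ·ₚ q) *ₚ r +ₚ (0# ·ₚ r +ₚ (0# ∷ (p *ₚ q) *ₚ r))
      ≈⟨ +ₚ-cong (·ₚ-*ₚ a q r) (+ₚ-cong (0·ₚ r) (∷-congˡ (*ₚ-assoc p q r))) ⟩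
    a ·ₚ (q *ₚ r) +ₚ (0# ∷ p *ₚ (q *ₚ r)) ∎

  *ₚ-identityˡ : ∀ p → (1# ∷ []) *ₚ p ≋ p
  *ₚ-identityˡ p = begin
    1# ·ₚ p +ₚ (0# ∷ [])  ≈⟨ +ₚ-cong (1·ₚ p) 0∷[]≋[] ⟩
    p +ₚ []               ≈⟨ +ₚ-identityʳ p ⟩
    p                     ∎

  -- Stated with `≈ₚ` instead of `≋`, so that its raw ring is the one in which `charPoly` takes the
  -- determinant.
  polyCommutativeRing : CommutativeRing c ℓ
  polyCommutativeRing = record
    { Carrier = Poly
    ; _≈_ = _≈ₚ_
    ; _+_ = _+ₚ_
    ; _*_ = _*ₚ_
    ; -_ = -ₚ_
    ; 0# = []
    ; 1# = 1# ∷ []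
    ; isCommutativeRing = record
      { isRing = record
        { +-isAbelianGroup = record
          { isGroup = record
            { isMonoid = record
              { isSemigroup = record
                { isMagma = record
                  { isEquivalence = record
                    { refl  = λ i → refl
                    ; sym   = λ p≈q i → sym (p≈q i)
                    ; trans = λ p≈q q≈r i → trans (p≈q i) (q≈r i)
                    }
                  ; ∙-cong = λ {p} {p′} {q} {q′} p≈ q≈ →
                      coeffs (+ₚ-cong {p} {p′} {q} {q′} (coeffwise p≈) (coeffwise q≈))
                  }
                ; assoc = λ p q r → coeffs (+ₚ-assoc p q r)
                }
              ; identity = (λ p i → refl) , λ p → coeffs (+ₚ-identityʳ p)
              }
            ; inverse = (λ p → coeffs (P.trans (P.comm (-ₚ p) p) (-ₚ-inverseʳ p)))
                      , λ p → coeffs (-ₚ-inverseʳ p)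
            ; ⁻¹-cong = λ {p} {q} p≈q → coeffs (-ₚ-cong {p} {q} (coeffwise p≈q))
            }
          ; comm = λ p q → coeffs (+ₚ-comm p q)
          }
        ; *-cong = λ {p} {p′} {q} {q′} p≈ q≈ →
            coeffs (*ₚ-cong {p} {p′} {q} {q′} (coeffwise p≈) (coeffwise q≈))
        ; *-assoc = λ p q r → coeffs (*ₚ-assoc p q r)
        ; *-identity = (λ p → coeffs (*ₚ-identityˡ p))
                     , λ p → coeffs (P.trans (*ₚ-comm p (1# ∷ [])) (*ₚ-identityˡ p))
        ; distrib = (λ p q r → coeffs (*ₚ-distribˡ p q r))
                  , λ p q r → coeffs (*ₚ-distribʳ p q r)
        }
      ; *-comm = λ p q → coeffs (*ₚ-comm p q)
      }
    }

  C-isRingHomomorphism : IsRingHomomorphism rawRing polyRawRing C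
  C-isRingHomomorphism = record
    { isSemiringHomomorphism = record
      { isNearSemiringHomomorphism = record
        { +-isMonoidHomomorphism = record
          { isMagmaHomomorphism = record
            { isRelHomomorphism = record { cong = λ a≈b → coeffs (∷-cong a≈b P.refl) }
            ; homo = λ a b i → refl
            }
          ; ε-homo = coeffs 0∷[]≋[]
          }
        ; *-homo = λ a b → coeffs (∷-cong (sym (+-identityʳ (a * b))) P.refl)
        }
      ; 1#-homo = λ i → refl
      }
    ; -‿homo = λ a i → refl
    }

-- Cancelling a monic linear factor

module LinearCancellation {c ℓ} (R : CommutativeRing c ℓ) where
  open import Data.List.Base using (_∷_)
  open CommutativeRing R hiding (zero)
  open RingProperties ring using (+-inverseʳ-unique; -‿distribˡ-*; -‿involutive)
  open Polynomials rawRing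
  open PolynomialRing R
  open import Relation.Binary.Reasoning.Setoid setoid

  private
    -- The coefficients vanish beyond the end of the list, and the recurrence carries this back to
    -- the front. The end of the list stands in for a degree, which cannot be computed without
    -- deciding equality.
    recurrence⇒≈[] : ∀ b p → (∀ i → coeff p i ≈ b * coeff p (suc i)) → p ≈ₚ []
    recurrence⇒≈[] b [] rec i = refl
    recurrence⇒≈[] b (a ∷ p) rec = λ
      { zero → trans (rec zero) (trans (*-congˡ (p≈[] zero)) (zeroʳ b))
      ; (suc i) → p≈[] i }
      where p≈[] = recurrence⇒≈[] b p (λ i → rec (suc i))

  X-C*ₚ≈[]⇒≈[] : ∀ b p → (X -ₚ C b) *ₚ p ≈ₚ [] → p ≈ₚ []
  X-C*ₚ≈[]⇒≈[] b p eq = recurrence⇒≈[] b p rec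
    where
    rec : ∀ i → coeff p i ≈ b * coeff p (suc i)
    rec i = begin
      coeff p i                            ≈⟨ +-inverseʳ-unique _ _ sum≈0 ⟩
      - ((0# - b) * coeff p (suc i))       ≈⟨ -‿cong (*-congʳ (+-identityˡ (- b))) ⟩
      - (- b * coeff p (suc i))            ≈⟨ -‿cong (-‿distribˡ-* b _) ⟨
      - - (b * coeff p (suc i))            ≈⟨ -‿involutive _ ⟩
      b * coeff p (suc i)                  ∎
      where
      -- `X -ₚ C b` computes to `(0# - b) ∷ 1# ∷ []`, so the left side is coefficient `suc i` of the
      -- product.
      sum≈0 : (0# - b) * coeff p (suc i) + coeff p i ≈ 0#
      sum≈0 = begin
        (0# - b) * coeff p (suc i) + coeff p i
          ≈⟨ +-cong (coeff-· (0# - b) p (suc i)) (coeffs (*ₚ-identityˡ p) i) ⟨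
        coeff ((0# - b) ·ₚ p) (suc i) + coeff ((1# ∷ []) *ₚ p) i
          ≈⟨ coeff-+ ((0# - b) ·ₚ p) (0# ∷ (1# ∷ []) *ₚ p) (suc i) ⟨
        coeff ((X -ₚ C b) *ₚ p) (suc i) ≈⟨ eq (suc i) ⟩
        0# ∎

  X-C-cancelˡ : ∀ b p q → (X -ₚ C b) *ₚ p ≈ₚ (X -ₚ C b) *ₚ q → p ≈ₚ q
  X-C-cancelˡ b p q eq = x∙y⁻¹≈ε⇒x≈y p q
    (X-C*ₚ≈[]⇒≈[] b (p -ₚ q) λ i →
      trans (x[y-z]≈xy-xz (X -ₚ C b) p q i)
            (x≈y⇒x∙y⁻¹≈ε {(X -ₚ C b) *ₚ p} {(X -ₚ C b) *ₚ q} eq i))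
    where
    open RingProperties (CommutativeRing.ring polyCommutativeRing)
      using (x[y-z]≈xy-xz; x∙y⁻¹≈ε⇒x≈y; x≈y⇒x∙y⁻¹≈ε)

-- Evaluation and substitution

module Evaluation {c₁ ℓ₁ c₂ ℓ₂} (R : CommutativeRing c₁ ℓ₁) (S : CommutativeRing c₂ ℓ₂)
  {⟦_⟧ : CommutativeRing.Carrier R → CommutativeRing.Carrier S}
  (isHom : IsRingHomomorphism (CommutativeRing.rawRing R) (CommutativeRing.rawRing S) ⟦_⟧)
  (y : CommutativeRing.Carrier S) where
  open import Data.List.Base using (_∷_)

  private
    module R = CommutativeRing R
  open Polynomials R.rawRing
  open PolynomialRing R using (_·ₚ_)
  open CommutativeRing S hiding (zero)
  open IsRingHomomorphism isHom
  open RingProperties ring using (-0#≈0#; -‿distribʳ-*; -‿+-comm)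
  open SemiringSolver commutativeSemiring using (solve; _:=_; _:+_; _:*_)
  open import Relation.Binary.Reasoning.Setoid setoid

  eval : Poly → Carrier
  eval [] = 0#
  eval (a ∷ p) = ⟦ a ⟧ + y * eval p

  private
    step : ∀ {a b u v} → a ≈ b → u ≈ v → a + y * u ≈ b + y * v
    step a≈b u≈v = +-cong a≈b (*-congˡ u≈v)

    step-zero : ∀ {a u} → a ≈ 0# → u ≈ 0# → a + y * u ≈ 0#
    step-zero a≈0 u≈0 = trans (step a≈0 u≈0) (trans (+-identityˡ _) (zeroʳ y))

    -- Equal polynomials may differ in length; this disposes of the surplus zeros.
    eval-≈[] : ∀ p → p ≈ₚ [] → eval p ≈ 0#
    eval-≈[] [] p≈ = refl
    eval-≈[] (a ∷ p) p≈ =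
      step-zero (trans (⟦⟧-cong (p≈ 0)) 0#-homo) (eval-≈[] p (λ i → p≈ (suc i)))

  eval-cong : ∀ p q → p ≈ₚ q → eval p ≈ eval q
  eval-cong [] q p≈q = sym (eval-≈[] q (λ i → R.sym (p≈q i)))
  eval-cong (a ∷ p) [] p≈q = eval-≈[] (a ∷ p) p≈q
  eval-cong (a ∷ p) (b ∷ q) p≈q = step (⟦⟧-cong (p≈q 0)) (eval-cong p q (λ i → p≈q (suc i)))

  eval-+ : ∀ p q → eval (p +ₚ q) ≈ eval p + eval q
  eval-+ [] q = sym (+-identityˡ _)
  eval-+ (a ∷ p) [] = sym (+-identityʳ _)
  eval-+ (a ∷ p) (b ∷ q) = trans (step (+-homo a b) (eval-+ p q))
    (solve 5 (λ a b y p q → a :+ b :+ y :* (p :+ q) := (a :+ y :* p) :+ (b :+ y :* q)) refl _ _ _ _ _)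

  eval-neg : ∀ p → eval (-ₚ p) ≈ - eval p
  eval-neg [] = sym -0#≈0#
  eval-neg (a ∷ p) = begin
    ⟦ R.- a ⟧ + y * eval (-ₚ p)  ≈⟨ step (-‿homo a) (eval-neg p) ⟩
    - ⟦ a ⟧ + y * - eval p       ≈⟨ +-congˡ (-‿distribʳ-* y _) ⟨
    - ⟦ a ⟧ - y * eval p         ≈⟨ -‿+-comm _ _ ⟩
    - (⟦ a ⟧ + y * eval p)       ∎

  eval-· : ∀ a p → eval (a ·ₚ p) ≈ ⟦ a ⟧ * eval p
  eval-· a [] = sym (zeroʳ _)
  eval-· a (b ∷ p) = trans (step (*-homo a b) (eval-· a p))
    (solve 4 (λ a b y p → a :* b :+ y :* (a :* p) := a :* (b :+ y :* p)) refl _ _ _ _)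

  eval-* : ∀ p q → eval (p *ₚ q) ≈ eval p * eval q
  eval-* [] q = sym (zeroˡ _)
  eval-* (a ∷ p) q = begin
    eval (a ·ₚ q +ₚ (R.0# ∷ p *ₚ q))            ≈⟨ eval-+ (a ·ₚ q) (R.0# ∷ p *ₚ q) ⟩
    eval (a ·ₚ q) + (⟦ R.0# ⟧ + y * eval (p *ₚ q))
      ≈⟨ +-cong (eval-· a q) (step 0#-homo (eval-* p q)) ⟩
    ⟦ a ⟧ * eval q + (0# + y * (eval p * eval q))
      ≈⟨ +-congˡ (+-identityˡ _) ⟩
    ⟦ a ⟧ * eval q + y * (eval p * eval q)
      ≈⟨ solve 4 (λ a y p q → a :* q :+ y :* (p :* q) := (a :+ y :* p) :* q) refl _ _ _ _ ⟩
    (⟦ a ⟧ + y * eval p) * eval q ∎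

  eval-C : ∀ a → eval (C a) ≈ ⟦ a ⟧
  eval-C a = trans (+-congˡ (zeroʳ y)) (+-identityʳ _)

  eval-X : eval X ≈ y
  eval-X = begin
    ⟦ R.0# ⟧ + y * eval (C R.1#) ≈⟨ step 0#-homo (trans (eval-C R.1#) 1#-homo) ⟩
    0# + y * 1#                   ≈⟨ +-identityˡ _ ⟩
    y * 1#                        ≈⟨ *-identityʳ y ⟩
    y                             ∎

  eval-isRingHomomorphism : IsRingHomomorphism polyRawRing rawRing eval
  eval-isRingHomomorphism = record
    { isSemiringHomomorphism = record
      { isNearSemiringHomomorphism = record
        { +-isMonoidHomomorphism = record
          { isMagmaHomomorphism = record
            { isRelHomomorphism = record { cong = λ {p} {q} → eval-cong p q }
            ; homo = eval-+
            }
          ; ε-homo = refl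
          }
        ; *-homo = eval-*
        }
      ; 1#-homo = trans (eval-C R.1#) 1#-homo
      }
    ; -‿homo = eval-neg
    }

-- Double counting

module DoubleCounting where
  open import Data.Fin.Subset using (Subset; _⊆_; _∈_; _∪_; ⁅_⁆; ∣_∣)
  open import Data.Fin.Subset.Properties
    using (_∈?_; _⊆?_; x∈p∪q⁺; x∈p∪q⁻; x∈⁅x⁆; x∈⁅y⁆⇒x≡y)
  open import Data.List.Base using (_∷_)
  open import Data.List.Relation.Unary.All using (All; []; _∷_)
  open import Data.Vec.Base using ([]; _∷_)
  open SemiringSum ℕ.+-*-semiring using (sum; sum-cong-≋; sum-replicate-zero; ∑-distrib-+)
  open ≡.≡-Reasoning

  indicator : Bool → ℕ
  indicator b = if b then 1 else 0

  length-filter-∷ : ∀ {a p} {A : Set a} {P : Pred A p} (P? : Decidable P) x xs →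
    length (filter P? (x ∷ xs)) ≡ indicator (does (P? x)) ℕ.+ length (filter P? xs)
  length-filter-∷ P? x xs with does (P? x)
  ... | true = ≡.refl
  ... | false = ≡.refl

  sum-δ : ∀ {n} (i : Fin n) → sum (λ j → indicator (does (i ≟ j))) ≡ 1
  sum-δ {suc n} zero = ≡.cong suc (sum-replicate-zero n)
  sum-δ (suc i) = sum-δ i

  sum-∈ : ∀ {n} (e : Subset n) → sum (λ j → indicator (does (j ∈? e))) ≡ ∣ e ∣
  sum-∈ [] = ≡.refl
  sum-∈ (true ∷ e) = ≡.cong suc (sum-∈ e)
  sum-∈ (false ∷ e) = sum-∈ e

  pair⊆⇒∈ : ∀ {n} {i j : Fin n} {e} → ⁅ i ⁆ ∪ ⁅ j ⁆ ⊆ e → i ∈ e × j ∈ e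
  pair⊆⇒∈ {i = i} {j} ⊆e = ⊆e (x∈p∪q⁺ (inj₁ (x∈⁅x⁆ i))) , ⊆e (x∈p∪q⁺ (inj₂ (x∈⁅x⁆ j)))

  ∈⇒pair⊆ : ∀ {n} {i j : Fin n} {e} → i ∈ e → j ∈ e → ⁅ i ⁆ ∪ ⁅ j ⁆ ⊆ e
  ∈⇒pair⊆ {i = i} {j} i∈e j∈e x∈ with x∈p∪q⁻ ⁅ i ⁆ ⁅ j ⁆ x∈
  ... | inj₁ x∈i rewrite x∈⁅y⁆⇒x≡y i x∈i = i∈e
  ... | inj₂ x∈j rewrite x∈⁅y⁆⇒x≡y j x∈j = j∈e

  -- Imposes the zero diagonal of `adjacency` on natural numbers, so that the counting stays in ℕ
  -- until the row sum is known.
  offDiagonal : ∀ {n} → (Fin n → Fin n → ℕ) → Fin n → Fin n → ℕ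
  offDiagonal f i j = if does (i ≟ j) then 0 else f i j

  covers : ∀ {n} → Subset n → Fin n → Fin n → ℕ
  covers e i j = indicator (does (⁅ i ⁆ ∪ ⁅ j ⁆ ⊆? e))

  -- An edge through `i` contributes once for each of its other vertices. Filling in 1 on the
  -- diagonal turns its row into the indicator of `e`, with sum `suc k`; cancelling that 1 avoids
  -- truncated subtraction.
  sum-covers : ∀ {n k} (e : Subset n) → ∣ e ∣ ≡ suc k → ∀ i →
    sum (offDiagonal (covers e) i) ≡ indicator (does (i ∈? e)) ℕ.* k
  sum-covers {n} {k} e ∣e∣≡ i with i ∈? e
  ... | no i∉e = ≡.trans (sum-cong-≋ term) (sum-replicate-zero n)
    where
    term : ∀ j → offDiagonal (covers e) i j ≡ 0
    term j with i ≟ j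
    ... | yes _ = ≡.refl
    ... | no _ = ≡.cong indicator (dec-false (⁅ i ⁆ ∪ ⁅ j ⁆ ⊆? e) (i∉e ∘ proj₁ ∘ pair⊆⇒∈))
  ... | yes i∈e = ≡.trans (ℕ.suc-injective (begin
      1 ℕ.+ sum (offDiagonal (covers e) i)
        ≡⟨ ≡.cong (ℕ._+ sum (offDiagonal (covers e) i)) (sum-δ i) ⟨
      sum (λ j → indicator (does (i ≟ j))) ℕ.+ sum (offDiagonal (covers e) i)
        ≡⟨ ∑-distrib-+ (λ j → indicator (does (i ≟ j))) (offDiagonal (covers e) i) ⟨
      sum (λ j → indicator (does (i ≟ j)) ℕ.+ offDiagonal (covers e) i j)
        ≡⟨ sum-cong-≋ term ⟩
      sum (λ j → indicator (does (j ∈? e)))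
        ≡⟨ ≡.trans (sum-∈ e) ∣e∣≡ ⟩
      suc k ∎)) (≡.sym (ℕ.*-identityˡ k))
    where
    term : ∀ j → indicator (does (i ≟ j)) ℕ.+ offDiagonal (covers e) i j ≡ indicator (does (j ∈? e))
    term j with i ≟ j
    ... | yes ≡.refl = ≡.cong indicator (≡.sym (dec-true (i ∈? e) i∈e))
    ... | no _ with j ∈? e
    ...   | yes j∈e = ≡.cong indicator (dec-true (⁅ i ⁆ ∪ ⁅ j ⁆ ⊆? e) (∈⇒pair⊆ i∈e j∈e))
    ...   | no j∉e = ≡.cong indicator (dec-false (⁅ i ⁆ ∪ ⁅ j ⁆ ⊆? e) (j∉e ∘ proj₂ ∘ pair⊆⇒∈))

  sum-codegree : ∀ {n k} (es : List (Subset n)) → All (λ e → ∣ e ∣ ≡ suc k) es → ∀ i →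
    sum (offDiagonal (λ i j → length (filter (⁅ i ⁆ ∪ ⁅ j ⁆ ⊆?_) es)) i) ≡
    length (filter (i ∈?_) es) ℕ.* k
  sum-codegree {n} [] [] i = ≡.trans (sum-cong-≋ term) (sum-replicate-zero n)
    where
    term : ∀ j → offDiagonal (λ _ _ → 0) i j ≡ 0
    term j with does (i ≟ j)
    ... | true = ≡.refl
    ... | false = ≡.refl
  sum-codegree {n} {k} (e ∷ es) (∣e∣≡ ∷ uniform) i = begin
    sum (offDiagonal (count (e ∷ es)) i)
      ≡⟨ sum-cong-≋ term ⟩
    sum (λ j → offDiagonal (covers e) i j ℕ.+ offDiagonal (count es) i j)
      ≡⟨ ∑-distrib-+ (offDiagonal (covers e) i) (offDiagonal (count es) i) ⟩
    sum (offDiagonal (covers e) i) ℕ.+ sum (offDiagonal (count es) i)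
      ≡⟨ ≡.cong₂ ℕ._+_ (sum-covers e ∣e∣≡ i) (sum-codegree es uniform i) ⟩
    indicator (does (i ∈? e)) ℕ.* k ℕ.+ length (filter (i ∈?_) es) ℕ.* k
      ≡⟨ ℕ.*-distribʳ-+ k (indicator (does (i ∈? e))) _ ⟨
    (indicator (does (i ∈? e)) ℕ.+ length (filter (i ∈?_) es)) ℕ.* k
      ≡⟨ ≡.cong (ℕ._* k) (length-filter-∷ (i ∈?_) e es) ⟨
    length (filter (i ∈?_) (e ∷ es)) ℕ.* k ∎
    where
    count : List (Subset n) → Fin n → Fin n → ℕ
    count es i j = length (filter (⁅ i ⁆ ∪ ⁅ j ⁆ ⊆?_) es)
    term : ∀ j →
      offDiagonal (count (e ∷ es)) i j ≡
      offDiagonal (covers e) i j ℕ.+ offDiagonal (count es) i j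
    term j with does (i ≟ j)
    ... | true = ≡.refl
    ... | false = length-filter-∷ (⁅ i ⁆ ∪ ⁅ j ⁆ ⊆?_) e es

  codegree-rowSum : ∀ {n k r} (G : Hypergraph n) → UniformRegular k r G → ∀ i →
    sum (offDiagonal (codegree G) i) ≡ r ℕ.* (k ℕ.∸ 1)
  -- The case of edge size zero is excluded by `2 ≤ k`; otherwise the truncated `k ∸ 1` is a true
  -- predecessor.
  codegree-rowSum {k = suc k} G ((_ , uniform) , regular) i =
    ≡.trans (sum-codegree (edges G) uniform i) (≡.cong (ℕ._* k) (regular i))

-- Characteristic polynomials

open import Data.Vec.Functional using (_∷_; map)
open DoubleCounting

-- The polynomial ring enters through the ring P, the constants C, the variable X
-- and a substitution φ, all abstract: equality of polynomials unfolds to a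
-- function type, which would block the inference of implicit arguments.
module SeidelSpectrum {c ℓ₁ ℓ₂ c′ ℓ′}
  (K : HeytingField c ℓ₁ ℓ₂) (P : CommutativeRing c′ ℓ′) where
  open HeytingField K hiding (zero)
  open Spectra K

  R : CommutativeRing c ℓ₁
  R = record { isCommutativeRing = isCommutativeRing }

  module R where
    open CommutativeRing R public
    open RingIdentities R public
    open SemiringSum (CommutativeRing.semiring R) public using (sum; sum-cong-≋; sum-replicate)

  module P where
    open CommutativeRing P public
    open RingIdentities P public
    open SemiringSum (CommutativeRing.semiring P) public using (sum; sum-cong-≋; *-distribˡ-sum)
    open RawSemiringDefs (Semiring.rawSemiring (CommutativeRing.semiring P)) public
      using (product; _^_)
    open Matrices (CommutativeRing.rawRing P) public using (Matrix; identity; det)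
    open Determinant P public
    open RingProperties (CommutativeRing.ring P) public
      using (-‿distribˡ-*; -‿distribʳ-*; -‿involutive)
  open P using () renaming (_+_ to _⊕_; _*_ to _⊗_; _-_ to _⊖_)

  adjacency-rowSum : ∀ {n k r} (G : Hypergraph n) → UniformRegular k r G → ∀ i →
    R.sum (adjacency G i) ≈ fromℕ (r ℕ.* (k ℕ.∸ 1))
  adjacency-rowSum {n} G reg i = R.trans (R.sum-cong-≋ entry)
    (R.trans (R.·-homo-sum (offDiagonal (codegree G) i))
             (R.reflexive (≡.cong fromℕ (codegree-rowSum G reg i))))
    where
    entry : ∀ j → adjacency G i j ≈ fromℕ (offDiagonal (codegree G) i j)
    entry j with does (i ≟ j)
    ... | true = R.refl
    ... | false = R.refl

  open Matrices rawRing using (Matrix; identity)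

  module _
    {C : Carrier → P.Carrier} (C-isHom : IsRingHomomorphism rawRing P.rawRing C)
    (X : P.Carrier)
    (X-C-cancelˡ : ∀ b p q → (X ⊖ C b) ⊗ p P.≈ (X ⊖ C b) ⊗ q → p P.≈ q)
    (½ : Carrier) (2½≈1 : fromℕ 2 * ½ ≈ 1#)
    {φ : P.Carrier → P.Carrier} (φ-isHom : IsRingHomomorphism P.rawRing P.rawRing φ)
    (φ-C : ∀ a → φ (C a) P.≈ C a) (φ-X : φ X P.≈ P.- (C ½ ⊗ (X ⊕ P.1#)))
    where

    private
      module C = IsRingHomomorphism C-isHom
      module φ = IsRingHomomorphism φ-isHom

    open import Relation.Binary.Reasoning.Setoid P.setoid

    two Y : P.Carrier
    two = C (fromℕ 2)
    Y = P.- (C ½ ⊗ (X ⊕ P.1#))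

    -2Y≈X+1 : P.- two ⊗ Y P.≈ X ⊕ P.1#
    -2Y≈X+1 = begin
      P.- two ⊗ Y                        ≈⟨ P.-‿distribˡ-* _ _ ⟨
      P.- (two ⊗ Y)                      ≈⟨ P.-‿cong (P.-‿distribʳ-* _ _) ⟨
      P.- P.- (two ⊗ (C ½ ⊗ (X ⊕ P.1#))) ≈⟨ P.-‿involutive _ ⟩
      two ⊗ (C ½ ⊗ (X ⊕ P.1#))           ≈⟨ P.*-assoc _ _ _ ⟨
      two ⊗ C ½ ⊗ (X ⊕ P.1#)
        ≈⟨ P.*-congʳ (P.trans (P.sym (C.*-homo _ _)) (P.trans (C.⟦⟧-cong 2½≈1) C.1#-homo)) ⟩
      P.1# ⊗ (X ⊕ P.1#)                  ≈⟨ P.*-identityˡ _ ⟩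
      X ⊕ P.1#                           ∎

    C-identity : ∀ {n} (i j : Fin n) → C (identity i j) P.≈ P.identity i j
    C-identity i j with does (i ≟ j)
    ... | true = C.1#-homo
    ... | false = C.0#-homo

    φ-identity : ∀ {n} (i j : Fin n) → φ (P.identity i j) P.≈ P.identity i j
    φ-identity i j with does (i ≟ j)
    ... | true = φ.1#-homo
    ... | false = φ.0#-homo

    C-difference : ∀ a b → C (a - b) P.≈ C a ⊖ C b
    C-difference a b = P.trans (C.+-homo _ _) (P.+-congˡ (C.-‿homo b))

    φ-difference : ∀ p q → φ (p ⊖ q) P.≈ φ p ⊖ φ q
    φ-difference p q = P.trans (φ.+-homo _ _) (P.+-congˡ (φ.-‿homo q))

    charMatrix : ∀ {n} → Matrix n → P.Matrix n
    charMatrix M i j = X ⊗ P.identity i j ⊖ C (M i j)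

    charMatrix-rowSum : ∀ {n} (M : Matrix n) i {a} → R.sum (M i) ≈ a →
      P.sum (charMatrix M i) P.≈ X ⊖ C a
    charMatrix-rowSum M i {a} rowSum = begin
      P.sum (charMatrix M i)
        ≈⟨ P.sum-difference (λ j → X ⊗ P.identity i j) (λ j → C (M i j)) ⟩
      P.sum (λ j → X ⊗ P.identity i j) ⊖ P.sum (λ j → C (M i j))
        ≈⟨ P.+-cong
             (P.trans (P.sym (P.*-distribˡ-sum X (P.identity i)))
                      (P.trans (P.*-congˡ (P.sum-identity i)) (P.*-identityʳ X)))
             (P.-‿cong (P.trans (P.sym (sum-homo R P C-isHom (M i))) (C.⟦⟧-cong rowSum))) ⟩
      X ⊖ C a ∎

    φ-charMatrix : ∀ {n} (M : Matrix n) i j →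
      φ (charMatrix M i j) P.≈ Y ⊗ P.identity i j ⊖ C (M i j)
    φ-charMatrix M i j = P.trans (φ-difference _ _)
      (P.+-cong (P.trans (φ.*-homo _ _) (P.*-cong φ-X (φ-identity i j)))
                (P.-‿cong (φ-C (M i j))))

    root : Carrier → Carrier
    root a = - 1# - fromℕ 2 * a

    C-root : ∀ b a → C (b - fromℕ 2 * a) P.≈ C b ⊖ two ⊗ C a
    C-root b a = P.trans (C-difference _ _) (P.+-congˡ (P.-‿cong (C.*-homo _ _)))

    C-1 : C (- 1#) P.≈ P.- P.1#
    C-1 = P.trans (C.-‿homo 1#) (P.-‿cong C.1#-homo)

    -- Serves both for the row sums of B and for the linear factors of its determinant, so that the
    -- row sum and the first factor come out as the same polynomial.
    rescale-linear : ∀ a → P.- two ⊗ φ (X ⊖ C a) P.≈ X ⊖ C (root a)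
    rescale-linear a = begin
      P.- two ⊗ φ (X ⊖ C a)
        ≈⟨ P.*-congˡ (P.trans (φ-difference _ _) (P.+-cong φ-X (P.-‿cong (φ-C a)))) ⟩
      P.- two ⊗ (Y ⊖ C a)
        ≈⟨ P.rescale-root -2Y≈X+1 P.refl (C a) ⟩
      X ⊖ (P.- P.1# ⊖ two ⊗ C a)
        ≈⟨ P.+-congˡ (P.-‿cong (P.trans (C-root (- 1#) a) (P.+-congʳ C-1))) ⟨
      X ⊖ C (root a) ∎

    -- For the adjacency matrix this is B, left as a scaled image under `φ` so that `det-scale` and
    -- `det-homo` apply to it directly.
    rescaled : ∀ {n} → Matrix n → P.Matrix n
    rescaled M i j = P.- two ⊗ φ (charMatrix M i j)

    charMatrix-seidel : ∀ {n} (G : Hypergraph n) i j →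
      charMatrix (seidel G) i j P.≈ rescaled (adjacency G) i j ⊖ P.1#
    charMatrix-seidel G i j = begin
      X ⊗ I ⊖ C (1# - identity i j - fromℕ 2 * a)
        ≈⟨ P.+-congˡ (P.-‿cong (P.trans (C-root (1# - identity i j) a) (P.+-congʳ
             (P.trans (C-difference _ _) (P.+-cong C.1#-homo (P.-‿cong (C-identity i j))))))) ⟩
      X ⊗ I ⊖ (P.1# ⊖ I ⊖ two ⊗ C a)
        ≈⟨ P.rescale-entry -2Y≈X+1 P.refl I (C a) ⟩
      P.- two ⊗ (Y ⊗ I ⊖ C a) ⊖ P.1#
        ≈⟨ P.+-congʳ (P.*-congˡ (φ-charMatrix (adjacency G) i j)) ⟨
      rescaled (adjacency G) i j ⊖ P.1# ∎
      where
      I = P.identity i j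
      a = adjacency G i j

    rescaled-rowSum : ∀ {n} (M : Matrix n) i {a} → R.sum (M i) ≈ a →
      P.sum (rescaled M i) P.≈ X ⊖ C (root a)
    rescaled-rowSum M i {a} rowSum = begin
      P.sum (rescaled M i)
        ≈⟨ P.*-distribˡ-sum (P.- two) (λ j → φ (charMatrix M i j)) ⟨
      P.- two ⊗ P.sum (λ j → φ (charMatrix M i j))
        ≈⟨ P.*-congˡ (sum-homo P P φ-isHom (charMatrix M i)) ⟨
      P.- two ⊗ φ (P.sum (charMatrix M i))
        ≈⟨ P.*-congˡ (φ.⟦⟧-cong (charMatrix-rowSum M i rowSum)) ⟩
      P.- two ⊗ φ (X ⊖ C a)
        ≈⟨ rescale-linear a ⟩
      X ⊖ C (root a) ∎

    -- The `n` factors -2 taken out of the determinant are returned one to each linear factor, which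
    -- makes it monic again after the substitution.
    det-rescaled : ∀ {n} (M : Matrix n) (μ : Vector Carrier n) →
      P.det (charMatrix M) P.≈ P.product (λ i → X ⊖ C (μ i)) →
      P.det (rescaled M) P.≈ P.product (λ i → X ⊖ C (root (μ i)))
    det-rescaled {n} M μ spectrum = begin
      P.det (rescaled M)
        ≈⟨ P.det-scale (P.- two) (λ i j → φ (charMatrix M i j)) ⟩
      (P.- two) P.^ n ⊗ P.det (λ i j → φ (charMatrix M i j))
        ≈⟨ P.*-congˡ (det-homo P P φ-isHom (charMatrix M)) ⟨
      (P.- two) P.^ n ⊗ φ (P.det (charMatrix M))
        ≈⟨ P.*-congˡ (φ.⟦⟧-cong spectrum) ⟩
      (P.- two) P.^ n ⊗ φ (P.product (λ i → X ⊖ C (μ i)))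
        ≈⟨ P.*-congˡ (product-homo P P φ-isHom (λ i → X ⊖ C (μ i))) ⟩
      (P.- two) P.^ n ⊗ P.product (λ i → φ (X ⊖ C (μ i)))
        ≈⟨ P.product-scale (P.- two) (λ i → φ (X ⊖ C (μ i))) ⟨
      P.product (λ i → P.- two ⊗ φ (X ⊖ C (μ i)))
        ≈⟨ P.product-cong (λ i → rescale-linear (μ i)) ⟩
      P.product (λ i → X ⊖ C (root (μ i))) ∎

    seidelSpectrum : ∀ {m k r} (G : Hypergraph (suc m)) → UniformRegular k r G →
      ∀ λ₁ (λs : Vector Carrier m) → λ₁ ≈ fromℕ (r ℕ.* (k ℕ.∸ 1)) →
      P.det (charMatrix (adjacency G)) P.≈ P.product (λ i → X ⊖ C ((λ₁ ∷ λs) i)) →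
      P.det (charMatrix (seidel G)) P.≈
        P.product (λ i → X ⊖ C (((fromℕ (suc m) - 1# - fromℕ 2 * λ₁) ∷ map root λs) i))
    seidelSpectrum {m} G reg λ₁ λs λ₁≈ spectrum = begin
      P.det (charMatrix (seidel G))
        ≈⟨ P.det-cong {M = charMatrix (seidel G)} {B-J} (charMatrix-seidel G) ⟩
      P.det B-J
        ≈⟨ P.det-constantRowSum B-J (s ⊖ N) B-J-rowSum ⟩
      (s ⊖ N) ⊗ P.det (P.withOnes B-J)
        ≈⟨ P.*-cong s-N≈ (P.trans (P.det-withOnes-subtractOnes B) det-withOnes-B) ⟩
      (X ⊖ C (fromℕ (suc m) - 1# - fromℕ 2 * λ₁)) ⊗ Q ∎
      where
      s N Q : P.Carrier
      s = X ⊖ C (root λ₁)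
      N = C (fromℕ (suc m))
      Q = P.product (λ i → X ⊖ C (root (λs i)))

      B B-J : P.Matrix (suc m)
      B = rescaled (adjacency G)
      B-J i j = B i j ⊖ P.1#

      B-rowSum : ∀ i → P.sum (B i) P.≈ s
      -- The count gives r(k-1); replacing it by `λ₁` makes the row sum the factor to be cancelled.
      B-rowSum i = rescaled-rowSum (adjacency G) i (R.trans (adjacency-rowSum G reg i) (R.sym λ₁≈))

      ones-rowSum : P.sum {suc m} (λ _ → P.1#) P.≈ N
      ones-rowSum = P.trans (P.sum-cong-≋ {suc m} (λ _ → P.sym C.1#-homo))
        (P.trans (P.sym (sum-homo R P C-isHom {suc m} (λ _ → 1#)))
                 (C.⟦⟧-cong (R.sum-replicate (suc m))))

      B-J-rowSum : ∀ i → P.sum (B-J i) P.≈ s ⊖ N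
      B-J-rowSum i = P.trans (P.sum-difference (B i) (λ _ → P.1#))
        (P.+-cong (B-rowSum i) (P.-‿cong ones-rowSum))

      det-withOnes-B : P.det (P.withOnes B) P.≈ Q
      det-withOnes-B = X-C-cancelˡ (root λ₁) _ _
        (P.trans (P.sym (P.det-constantRowSum B s B-rowSum))
                 (det-rescaled (adjacency G) (λ₁ ∷ λs) spectrum))

      s-N≈ : s ⊖ N P.≈ X ⊖ C (fromℕ (suc m) - 1# - fromℕ 2 * λ₁)
      s-N≈ = begin
        X ⊖ C (root λ₁) ⊖ N
          ≈⟨ P.+-congʳ (P.+-congˡ (P.-‿cong (P.trans (C-root (- 1#) λ₁) (P.+-congʳ C-1)))) ⟩
        X ⊖ (P.- P.1# ⊖ two ⊗ C λ₁) ⊖ N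
          ≈⟨ P.shift-root X N (two ⊗ C λ₁) ⟩
        X ⊖ (N ⊖ P.1# ⊖ two ⊗ C λ₁)
          ≈⟨ P.+-congˡ (P.-‿cong (P.trans (C-root (fromℕ (suc m) - 1#) λ₁)
               (P.+-congʳ (P.trans (C-difference _ _) (P.+-congˡ (P.-‿cong C.1#-homo)))))) ⟨
        X ⊖ C (fromℕ (suc m) - 1# - fromℕ 2 * λ₁) ∎

theorem3p6 : ∀ {c ℓ₁ ℓ₂} (K : HeytingField c ℓ₁ ℓ₂) →
    let open HeytingField K
        open Spectra K
    in CharacteristicZero →
       ∀ {m k r : ℕ} (G : Hypergraph (suc m)) → UniformRegular k r G →
       ∀ (λ₁ : Carrier) (λs : Vector Carrier m) →
       λ₁ ≈ fromℕ (r ℕ.* (k ℕ.∸ 1)) →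
       HasSpectrum (adjacency G) (λ₁ ∷ λs) →
       HasSpectrum (seidel G)
         ((fromℕ (suc m) - 1# - fromℕ 2 * λ₁) ∷ map (λ μ → - 1# - fromℕ 2 * μ) λs)
theorem3p6 K charZero = seidelSpectrum C-isRingHomomorphism X X-C-cancelˡ ½ 2½≈1
    eval-isRingHomomorphism eval-C eval-X
  where
  open HeytingField K
  open Spectra K
  R : CommutativeRing _ _
  R = record { isCommutativeRing = isCommutativeRing }
  open Polynomials rawRing
  open PolynomialRing R using (polyCommutativeRing; C-isRingHomomorphism)
  open LinearCancellation R using (X-C-cancelˡ)
  open SeidelSpectrum K polyCommutativeRing using (seidelSpectrum)
  open RingProperties (CommutativeRing.ring R) using (-0#≈0#)
  -- `charZero 1` concerns `fromℕ (suc 1)`, that is 2. The inverse comes for `fromℕ 2 - 0#`, hence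
  -- the simplification in `2½≈1`.
  invertible = #⇒invertible (charZero 1)
  ½ = proj₁ invertible
  2½≈1 : fromℕ 2 * ½ ≈ 1#
  2½≈1 = trans (*-congʳ (sym (trans (+-congˡ -0#≈0#) (+-identityʳ (fromℕ 2)))))
               (proj₂ (proj₂ invertible))
  -- Evaluation with values in K[X] itself, at Y, is the substitution `φ`.
  open Evaluation R polyCommutativeRing C-isRingHomomorphism (-ₚ (C ½ *ₚ (X +ₚ C 1#)))
    using (eval-isRingHomomorphism; eval-C; eval-X)
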